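{- Let $F_{3,2}$ be the $3$-graph on vertex set $\{1,2,3,4,5\}$ with $3$-edges $123, 145, 245, 345$. For every positive integer $n$, $$\mathrm{co^+ex}(n,F_{3,2})\le \frac n2 .$$ Moreover, if $H$ is an $F_{3,2}$-free $n$-vertex $3$-graph with $\delta_2^+(H)=n/2$, then $n$ is divisible by $4$ and $H$ is the complete balanced $4$-partite $3$-graph.
   Context: A $3$-graph is a finite $3$-uniform hypergraph; an edge is written as the concatenation of its vertices. The minimum positive co-degree $\delta_2^+(H)$ of a non-empty $3$-graph $H$ is the maximum $k$ such that every pair of vertices contained in some edge of $H$ is contained in at least $k$ distinct edges of $H$; by convention it is $0$ if $H$ has no edges. A hypergraph is $F$-free if it has no (not necessarily induced) subhypergraph isomorphic to $F$. $\mathrm{co^+ex}(n,F)$ is the maximum of $\delta_2^+(H)$ over all $n$-vertex $F$-free $3$-graphs $H$. The complete balanced $4$-partite $3$-graph on $n$ vertices has its vertex set partitioned into four classes whose sizes differ by at most $1$, and its edges are all triples meeting each class in at most one vertex. -}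

module Defs where

open import Data.Bool.Properties using () renaming (_≟_ to _≟ᵇ_)
open import Data.Fin.Base using (Fin; zero; suc; finToFun; funToFin)
open import Data.Fin.Patterns using (0F; 1F; 2F; 3F; 4F)
open import Data.Fin.Properties using (_≟_; any?; all?; finToFun-funToFin; suc-injective)
open import Data.Fin.Subset using (Subset; inside; outside; ⁅_⁆; _∩_; _∪_; ∣_∣) renaming (_∈_ to _∈ₛ_)
open import Data.Fin.Subset.Properties using () renaming (_∈?_ to _∈ₛ?_)
open import Data.List.Base using (List; []; _∷_; _++_; map; filter; length; mapMaybe; upTo)
open import Data.List.Extrema.Nat using (max; argmax-sel; xs≤max; max≤v⁺)
open import Data.List.Membership.Propositional using (_∈_; find; lose)
open import Data.List.Membership.Propositional.Properties using (∈-map⁺; ∈-map⁻; ∈-++⁺ˡ; ∈-++⁺ʳ; ∈-filter⁺; ∈-filter⁻; ∈-upTo⁺; ∈-upTo⁻)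
open import Data.List.Membership.Propositional.Properties.WithK using (unique∧set⇒bag)
open import Data.List.Properties using (length-filter)
open import Data.List.Relation.Binary.BagAndSetEquality using (∼bag⇒↭)
open import Data.List.Relation.Binary.Permutation.Propositional using (_↭_; ↭-sym)
open import Data.List.Relation.Binary.Permutation.Propositional.Properties using (↭-length; filter-↭; ∈-resp-↭; Any-resp-↭; All-resp-↭)
open import Data.List.Relation.Unary.All as All using (All; []; _∷_)
import Data.List.Relation.Unary.All.Properties as All
open import Data.List.Relation.Unary.Any as Any using (Any; here; there)
open import Data.List.Relation.Unary.Any.Properties using (mapMaybe⁺)
open import Data.List.Relation.Unary.AllPairs using ([]; _∷_)
open import Data.List.Relation.Unary.Unique.Propositional using (Unique)
open import Data.List.Relation.Unary.Unique.Propositional.Properties using () renaming (map⁺ to Unique-map⁺; ++⁺ to Unique-++⁺; filter⁺ to Unique-filter⁺)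
open import Data.Maybe.Base as Maybe using (Maybe; just; nothing)
import Data.Maybe.Relation.Unary.Any as MAny
open import Data.Nat.Base using (ℕ; zero; suc; _≤_; _^_; s≤s; s≤s⁻¹; z≤n)
import Data.Nat.Properties as ℕ
open import Data.Product.Base using (∃; ∃₂; ∃-syntax; _×_; _,_; proj₁; proj₂)
open import Data.Sum.Base using (inj₁; inj₂)
open import Data.Vec.Base as Vec using ([]; _∷_; tabulate)
open import Data.Vec.Properties using (≡-dec; tabulate-cong; ∷-injectiveʳ)
open import Function.Base using (_∘_; case_of_)
open import Function.Bundles using (_⇔_; mk⇔)
open import Function.Definitions using (Injective)
open import Relation.Binary.Definitions using (DecidableEquality)
open import Relation.Binary.PropositionalEquality using (_≡_; _≢_; _≗_; refl; sym; trans; cong; subst)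
open import Relation.Nullary using (¬_; Dec; yes; no; does; contradiction)
open import Relation.Nullary.Decidable using (map′; ¬?; _×-dec_; _→-dec_; dec⇒maybe; does-⇔; from-yes)

private
  variable
    m n : ℕ

_≟ₛ_ : DecidableEquality (Subset n)
_≟ₛ_ = ≡-dec _≟ᵇ_

module _ {n : ℕ} where
  open import Data.List.Relation.Unary.Unique.DecPropositional (_≟ₛ_ {n}) public using (unique?)
  open import Data.List.Membership.DecPropositional (_≟ₛ_ {n}) public using (_∈?_)

-- The order in which the edges are listed carries no information: two 3-graphs
-- are the same when their edge lists have the same members.
record ThreeGraph (n : ℕ) : Set where
  field
    edges   : List (Subset n)
    unique  : Unique edges
    uniform : All (λ e → ∣ e ∣ ≡ 3) edges

open ThreeGraph public

image : (Fin m → Fin n) → Subset m → Subset n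
image φ e = tabulate λ y → does (any? λ x → (x ∈ₛ? e) ×-dec (φ x ≟ y))

IsEmbedding : ThreeGraph m → ThreeGraph n → (Fin m → Fin n) → Set
IsEmbedding F H φ = Injective _≡_ _≡_ φ × All (λ e → image φ e ∈ edges H) (edges F)

_Contains_ : ThreeGraph n → ThreeGraph m → Set
H Contains F = ∃ (IsEmbedding F H)

_-Free : ThreeGraph m → ThreeGraph n → Set
(F -Free) H = ¬ (H Contains F)

HasPair : Fin n → Fin n → Subset n → Set
HasPair x y e = x ∈ₛ e × y ∈ₛ e

hasPair? : (x y : Fin n) (e : Subset n) → Dec (HasPair x y e)
hasPair? x y e = (x ∈ₛ? e) ×-dec (y ∈ₛ? e)

codegree : ThreeGraph n → Fin n → Fin n → ℕ
codegree H x y = length (filter (hasPair? x y) (edges H))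

PositiveCodegreesAtLeast : ThreeGraph n → ℕ → Set
PositiveCodegreesAtLeast H k =
  ∀ x y → x ≢ y → Any (HasPair x y) (edges H) → k ≤ codegree H x y

positiveCodegreesAtLeast? : (H : ThreeGraph n) (k : ℕ) → Dec (PositiveCodegreesAtLeast H k)
positiveCodegreesAtLeast? H k = all? λ x → all? λ y →
  ¬? (x ≟ y) →-dec (Any.any? (hasPair? x y) (edges H) →-dec (k ℕ.≤? codegree H x y))

-- The search for the largest k stops at the number of edges, which no co-degree
-- exceeds (see δ₂⁺-maximum).  For a 3-graph without edges only k ≡ 0 is
-- searched, which gives the conventional value 0.
δ₂⁺ : ThreeGraph n → ℕ
δ₂⁺ H = max 0 (filter (positiveCodegreesAtLeast? H) (upTo (suc (length (edges H)))))

allSubsets : ∀ n → List (Subset n)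
allSubsets zero    = [] ∷ []
allSubsets (suc n) = map (inside ∷_) (allSubsets n) ++ map (outside ∷_) (allSubsets n)

sublists : ∀ {A : Set} → List A → List (List A)
sublists []       = [] ∷ []
sublists (x ∷ xs) = map (x ∷_) (sublists xs) ++ sublists xs

threeGraph? : List (Subset n) → Maybe (ThreeGraph n)
threeGraph? es = Maybe.map (λ (u , s) → record { edges = es ; unique = u ; uniform = s })
  (dec⇒maybe (unique? es ×-dec All.all? (λ e → ∣ e ∣ ℕ.≟ 3) es))

allThreeGraphs : ∀ n → List (ThreeGraph n)
allThreeGraphs n = mapMaybe threeGraph? (sublists (allSubsets n))

image-cong : {φ ψ : Fin m → Fin n} → φ ≗ ψ → ∀ e → image φ e ≡ image ψ e
image-cong {φ = φ} {ψ} φ≗ψ e = tabulate-cong λ y → does-⇔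
  (mk⇔ (λ (x , x∈e , eq) → x , x∈e , trans (sym (φ≗ψ x)) eq)
       (λ (x , x∈e , eq) → x , x∈e , trans (φ≗ψ x) eq))
  (any? λ x → (x ∈ₛ? e) ×-dec (φ x ≟ y))
  (any? λ x → (x ∈ₛ? e) ×-dec (ψ x ≟ y))

isEmbedding-cong : (F : ThreeGraph m) (H : ThreeGraph n) {φ ψ : Fin m → Fin n} →
  φ ≗ ψ → IsEmbedding F H φ → IsEmbedding F H ψ
isEmbedding-cong F H φ≗ψ (inj , emb) =
  (λ {x} {y} eq → inj (trans (φ≗ψ x) (trans eq (sym (φ≗ψ y))))) ,
  All.map (λ {e} → subst (_∈ edges H) (image-cong φ≗ψ e)) emb

isEmbedding? : (F : ThreeGraph m) (H : ThreeGraph n) (φ : Fin m → Fin n) → Dec (IsEmbedding F H φ)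
isEmbedding? F H φ =
  map′ (λ inj {x} {y} → inj x y) (λ inj x y → inj)
    (all? λ x → all? λ y → (φ x ≟ φ y) →-dec (x ≟ y))
  ×-dec All.all? (λ e → image φ e ∈? edges H) (edges F)

contains? : (H : ThreeGraph n) (F : ThreeGraph m) → Dec (H Contains F)
contains? {n} {m} H F = map′
  (λ (k , emb) → finToFun k , emb)
  (λ (φ , emb) → funToFin φ , isEmbedding-cong F H (sym ∘ finToFun-funToFin φ) emb)
  (any? {n ^ m} λ k → isEmbedding? F H (finToFun k))

free? : (F : ThreeGraph m) (H : ThreeGraph n) → Dec ((F -Free) H)
free? F H = ¬? (contains? H F)

co⁺ex : ℕ → ThreeGraph m → ℕ
co⁺ex n F = max 0 (map δ₂⁺ (filter (free? F) (allThreeGraphs n)))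

class : (Fin n → Fin 4) → Fin 4 → Subset n
class c i = tabulate λ v → does (c v ≟ i)

record IsCompleteBalanced4Partite (H : ThreeGraph n) : Set where
  field
    colour   : Fin n → Fin 4
    balanced : ∀ i j → ∣ class colour i ∣ ≤ suc ∣ class colour j ∣
    complete : ∀ e → e ∈ edges H ⇔ (∣ e ∣ ≡ 3 × (∀ i → ∣ e ∩ class colour i ∣ ≤ 1))

triple : Fin n → Fin n → Fin n → Subset n
triple x y z = ⁅ x ⁆ ∪ ⁅ y ⁆ ∪ ⁅ z ⁆

-- The vertices 1, …, 5 are 0F, …, 4F.
F₃,₂ : ThreeGraph 5
F₃,₂ = record
  { edges   = es
  ; unique  = from-yes (unique? es)
  ; uniform = from-yes (All.all? (λ e → ∣ e ∣ ℕ.≟ 3) es)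
  }
  where
  es : List (Subset 5)
  es = triple 0F 1F 2F ∷ triple 0F 3F 4F ∷ triple 1F 3F 4F ∷ triple 2F 3F 4F ∷ []

private
  max-∈ : ∀ x xs → x ∈ xs → max 0 xs ∈ xs
  max-∈ x xs x∈xs with argmax-sel (λ k → k) 0 xs
  ... | inj₂ max∈xs = max∈xs
  ... | inj₁ max≡0  = subst (_∈ xs)
    (trans (ℕ.n≤0⇒n≡0 (subst (x ≤_) max≡0 (All.lookup (xs≤max 0 xs) x∈xs))) (sym max≡0)) x∈xs

  nonempty : ∀ {k} (e : Subset n) → ∣ e ∣ ≡ suc k → ∃ (_∈ₛ e)
  nonempty (inside  ∷ e) eq = zero , Vec.here
  nonempty (outside ∷ e) eq = let x , x∈e = nonempty e eq in suc x , Vec.there x∈e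

  twoVertices : ∀ {k} (e : Subset n) → ∣ e ∣ ≡ suc (suc k) → ∃₂ λ x y → x ≢ y × HasPair x y e
  twoVertices (inside  ∷ e) eq =
    let y , y∈e = nonempty e (ℕ.suc-injective eq) in zero , suc y , (λ ()) , Vec.here , Vec.there y∈e
  twoVertices (outside ∷ e) eq =
    let x , y , x≢y , x∈e , y∈e = twoVertices e eq in
    suc x , suc y , (x≢y ∘ suc-injective) , Vec.there x∈e , Vec.there y∈e

δ₂⁺-attained : (H : ThreeGraph n) → PositiveCodegreesAtLeast H (δ₂⁺ H)
δ₂⁺-attained H = proj₂ (∈-filter⁻ (positiveCodegreesAtLeast? H) {xs = upTo (suc (length (edges H)))}
  (max-∈ 0 _ (∈-filter⁺ (positiveCodegreesAtLeast? H) (∈-upTo⁺ (s≤s z≤n)) λ _ _ _ _ → z≤n)))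

δ₂⁺-maximum : (H : ThreeGraph n) → edges H ≢ [] →
  ∀ k → PositiveCodegreesAtLeast H k → k ≤ δ₂⁺ H
δ₂⁺-maximum H H≢∅ k k-lower = All.lookup (xs≤max 0 _)
  (∈-filter⁺ (positiveCodegreesAtLeast? H) (∈-upTo⁺ (s≤s (bound (edges H) refl))) k-lower)
  where
  bound : ∀ es → edges H ≡ es → k ≤ length (edges H)
  bound []       eq = contradiction eq H≢∅
  bound (e ∷ es) eq =
    let e∈H                = subst (e ∈_) (sym eq) (here refl)
        x , y , x≢y , pair = twoVertices e (All.lookup (uniform H) e∈H)
    in ℕ.≤-trans (k-lower x y x≢y (lose e∈H pair)) (length-filter (hasPair? x y) (edges H))

δ₂⁺-empty : (H : ThreeGraph n) → edges H ≡ [] → δ₂⁺ H ≡ 0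
δ₂⁺-empty H H≡∅ = ℕ.n≤0⇒n≡0 (subst (λ es → δ₂⁺ H ≤ length es) H≡∅
  (max≤v⁺ z≤n (All.filter⁺ (positiveCodegreesAtLeast? H)
    (All.tabulate λ k∈ → s≤s⁻¹ (∈-upTo⁻ k∈)))))

private
  δ₂⁺-empty-≤ : (H : ThreeGraph n) → edges H ≡ [] → ∀ {k} → δ₂⁺ H ≤ k
  δ₂⁺-empty-≤ H eq = subst (_≤ _) (sym (δ₂⁺-empty H eq)) z≤n

  ∈-allSubsets : (e : Subset n) → e ∈ allSubsets n
  ∈-allSubsets []            = here refl
  ∈-allSubsets (inside  ∷ e) = ∈-++⁺ˡ (∈-map⁺ (inside ∷_) (∈-allSubsets e))
  ∈-allSubsets {suc n} (outside ∷ e) =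
    ∈-++⁺ʳ (map (inside ∷_) (allSubsets n)) (∈-map⁺ (outside ∷_) (∈-allSubsets e))

  allSubsets-unique : ∀ n → Unique (allSubsets n)
  allSubsets-unique zero    = [] ∷ []
  allSubsets-unique (suc n) = Unique-++⁺
    (Unique-map⁺ ∷-injectiveʳ (allSubsets-unique n))
    (Unique-map⁺ ∷-injectiveʳ (allSubsets-unique n))
    λ (p , q) → case (∈-map⁻ (inside ∷_) p , ∈-map⁻ (outside ∷_) q) of λ where
      ((_ , _ , refl) , (_ , _ , ()))

  filter-∈-sublists : ∀ {A : Set} {P : A → Set} (P? : ∀ x → Dec (P x)) xs → filter P? xs ∈ sublists xs
  filter-∈-sublists P? []       = here refl
  filter-∈-sublists P? (x ∷ xs) with P? x
  ... | yes _ = ∈-++⁺ˡ (∈-map⁺ (x ∷_) (filter-∈-sublists P? xs))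
  ... | no  _ = ∈-++⁺ʳ (map (x ∷_) (sublists xs)) (filter-∈-sublists P? xs)

  threeGraph?-complete : (es : List (Subset n)) → Unique es → All (λ e → ∣ e ∣ ≡ 3) es →
    MAny.Any (λ H → edges H ≡ es) (threeGraph? es)
  threeGraph?-complete es u s with unique? es ×-dec All.all? (λ e → ∣ e ∣ ℕ.≟ 3) es
  ... | yes _ = MAny.just refl
  ... | no ¬p = contradiction (u , s) ¬p

allThreeGraphs-complete : (H : ThreeGraph n) →
  ∃[ H′ ] H′ ∈ allThreeGraphs n × edges H′ ↭ edges H
allThreeGraphs-complete {n} H =
  let H′ , H′∈all , eq = find found in H′ , H′∈all , subst (_↭ edges H) (sym eq) es↭
  where
  member? = λ e → e ∈? edges H
  es      = filter member? (allSubsets n)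

  es↭ : es ↭ edges H
  es↭ = ∼bag⇒↭ (unique∧set⇒bag
    (Unique-filter⁺ member? (allSubsets-unique n)) (unique H)
    (λ {e} → mk⇔ (proj₂ ∘ ∈-filter⁻ member? {xs = allSubsets n}) (∈-filter⁺ member? (∈-allSubsets e))))

  found : Any (λ H′ → edges H′ ≡ es) (allThreeGraphs n)
  found = mapMaybe⁺ threeGraph? (sublists (allSubsets n))
    (lose (∈-map⁺ threeGraph? (filter-∈-sublists member? (allSubsets n)))
      (threeGraph?-complete es
        (Unique-filter⁺ member? (allSubsets-unique n))
        (All-resp-↭ (↭-sym es↭) (uniform H))))

private
  δ₂⁺-mono-↭ : (H H′ : ThreeGraph n) → edges H′ ↭ edges H → δ₂⁺ H ≤ δ₂⁺ H′
  δ₂⁺-mono-↭ H H′ H′↭H = go (edges H) refl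
    where
    go : ∀ es → edges H ≡ es → δ₂⁺ H ≤ δ₂⁺ H′
    go []      eq = δ₂⁺-empty-≤ H eq
    go (e ∷ _) eq = δ₂⁺-maximum H′
      (λ H′≡∅ → case subst (e ∈_) H′≡∅
                  (∈-resp-↭ (↭-sym H′↭H) (subst (e ∈_) (sym eq) (here refl))) of λ ())
      (δ₂⁺ H)
      (λ x y x≢y pos → subst (δ₂⁺ H ≤_)
        (↭-length (filter-↭ (hasPair? x y) (↭-sym H′↭H)))
        (δ₂⁺-attained H x y x≢y (Any-resp-↭ H′↭H pos)))

  free-resp-↭ : (F : ThreeGraph m) (H H′ : ThreeGraph n) → edges H′ ↭ edges H →
    (F -Free) H → (F -Free) H′
  free-resp-↭ F H H′ H′↭H free (φ , inj , emb) = free (φ , inj , All.map (∈-resp-↭ H′↭H) emb)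

co⁺ex-upper : (F : ThreeGraph m) (H : ThreeGraph n) → (F -Free) H → δ₂⁺ H ≤ co⁺ex n F
co⁺ex-upper F H free =
  let H′ , H′∈all , H′↭H = allThreeGraphs-complete H in
  ℕ.≤-trans (δ₂⁺-mono-↭ H H′ H′↭H)
    (All.lookup (xs≤max 0 _) (∈-map⁺ δ₂⁺
      (∈-filter⁺ (free? F) H′∈all (free-resp-↭ F H H′ H′↭H free))))

-- An F without edges is contained in every 3-graph with enough vertices, so
-- there the maximum may be over the empty set and co⁺ex takes the value 0.
co⁺ex-attained : ∀ n (F : ThreeGraph m) → edges F ≢ [] →
  ∃ λ (H : ThreeGraph n) → (F -Free) H × δ₂⁺ H ≡ co⁺ex n F
co⁺ex-attained n F F≢∅ =
  let H , H∈ , eq = ∈-map⁻ δ₂⁺ (max-∈ _ _ (∈-map⁺ δ₂⁺ ∅′∈))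
  in H , proj₂ (∈-filter⁻ (free? F) {xs = allThreeGraphs n} H∈) , sym eq
  where
  ∅ : ThreeGraph n
  ∅ = record { edges = [] ; unique = [] ; uniform = [] }

  ∅-free : (F -Free) ∅
  ∅-free (_ , _ , emb) with edges F
  ∅-free (_ , _ , emb) | [] = F≢∅ refl
  ∅-free (_ , _ , () ∷ _) | _ ∷ _

  ∅′ = allThreeGraphs-complete ∅

  ∅′∈ : proj₁ ∅′ ∈ filter (free? F) (allThreeGraphs n)
  ∅′∈ = ∈-filter⁺ (free? F) (proj₁ (proj₂ ∅′))
    (free-resp-↭ F ∅ (proj₁ ∅′) (proj₂ (proj₂ ∅′)) ∅-free)

{-# OPTIONS --safe #-}

-- A 3-graph is F₃,₂-free exactly when every link N(x, y) is independent.  If a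
-- link N(p, q) contains a pair a, b lying in an edge, then N(a, b) is disjoint
-- from N(p, q); if it contains no such pair, then N(p, z) is disjoint from
-- N(p, q) for every z ∈ N(p, q).  Two disjoint links give 2 δ₂⁺ ≤ n.
--
-- If 2 δ₂⁺ ≡ n, disjoint links are complementary, the second alternative is
-- impossible (p lies in neither link), and a, b, p, q span all four triples.
-- Moreover a pair of positive co-degree on one side of the cut given by a link
-- has the other side as its link.  The three cuts coming from the vertices
-- r₀, …, r₃ of such a K₄ then sort the vertices into four classes, the class of
-- rᵢ consisting of the vertices in no N(rᵢ, rⱼ).
module Submission where

open import Defs
open import Data.Bool.Base using (true)
open import Data.Fin.Base using (Fin)
open import Data.Fin.Patterns using (0F; 1F; 2F; 3F; 4F)
open import Data.Fin.Properties using (_≟_; any?; all?)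
open import Data.Fin.Subset using (Subset; inside; outside; ⁅_⁆; ⊤; _∩_; _∪_; _-_; ∣_∣; _⊆_) renaming (_∈_ to _∈ₛ_; _∉_ to _∉ₛ_)
open import Data.Fin.Subset.Properties using (⊆-antisym; ⊆⊤; ∈⊤; ∣⊤∣≡n; ∣p∣≤n; ∣⁅x⁆∣≡1; Empty-unique; ∣⊥∣≡0; x∈⁅x⁆; x∈⁅y⁆⇒x≡y; x∈p∪q⁺; x∈p∪q⁻; x∈p∩q⁺; x∈p∩q⁻; p⊆q⇒∣p∣≤∣q∣; p⊂q⇒∣p∣<∣q∣; x∈p∧x≢y⇒x∈p-y; x∈p⇒∣p-x∣<∣p∣) renaming (_∈?_ to _∈ₛ?_)
open import Data.List.Base using (List; []; _∷_; length)
open import Data.List.Membership.Propositional using (_∈_; lose)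
open import Data.List.Membership.Propositional.Properties using (∈-filter⁻)
open import Data.List.Relation.Unary.All as All using (All; []; _∷_)
open import Data.List.Relation.Unary.Any using (here)
open import Data.List.Relation.Unary.AllPairs using ([]; _∷_; allPairs?)
open import Data.List.Relation.Unary.Unique.Propositional using (Unique)
open import Data.List.Relation.Unary.Unique.Propositional.Properties using () renaming (filter⁺ to Unique-filter⁺)
open import Data.Nat using (ℕ; suc; _+_; _*_; _≤_; _<_; z≤n; s≤s; NonZero; ≢-nonZero⁻¹)
open import Data.Nat.Divisibility using (_∣_; divides)
import Data.Nat.Properties as ℕ
open import Data.Nat.Tactic.RingSolver using (solve-∀)
open import Data.Product using (∃; ∃-syntax; _×_; _,_; proj₁; proj₂)
open import Data.Sum using (_⊎_; inj₁; inj₂; [_,_])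
open import Data.Vec.Base using ([]; _∷_; tabulate)
open import Data.Vec.Properties using (lookup∘tabulate; lookup⇒[]=; []=⇒lookup)
open import Function.Base using (_∘_; case_of_)
open import Function.Bundles using (_⇔_; mk⇔; Equivalence)
open import Relation.Binary.PropositionalEquality using (_≡_; _≢_; refl; sym; trans; cong; cong₂; subst; subst₂; ≢-sym)
open import Relation.Nullary using (¬_; Dec; yes; no; does; contradiction)
open import Relation.Nullary.Decidable using (from-yes; dec-true; ¬?; _×-dec_; _→-dec_; _⊎-dec_; decidable-stable)
open import Relation.Unary using (Decidable)

private
  variable
    m n : ℕ

-- Membership in comprehensions and sizes of finite subsets.

module _ {P : Fin n → Set} (P? : Decidable P) where

  ∈-tabulate⁺ : ∀ {x} → P x → x ∈ₛ tabulate (does ∘ P?)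
  ∈-tabulate⁺ {x} px = lookup⇒[]= x _ (trans (lookup∘tabulate (does ∘ P?) x) (dec-true (P? x) px))

  ∈-tabulate⁻ : ∀ {x} → x ∈ₛ tabulate (does ∘ P?) → P x
  ∈-tabulate⁻ {x} x∈ = from-does (P? x) (trans (sym (lookup∘tabulate (does ∘ P?) x)) ([]=⇒lookup x∈))
    where
    from-does : (d : Dec (P x)) → does d ≡ true → P x
    from-does (yes px) _ = px

∣p∪q∣+∣p∩q∣≡∣p∣+∣q∣ : (p q : Subset n) → ∣ p ∪ q ∣ + ∣ p ∩ q ∣ ≡ ∣ p ∣ + ∣ q ∣
∣p∪q∣+∣p∩q∣≡∣p∣+∣q∣ []            []            = refl
∣p∪q∣+∣p∩q∣≡∣p∣+∣q∣ (outside ∷ p) (outside ∷ q) = ∣p∪q∣+∣p∩q∣≡∣p∣+∣q∣ p q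
∣p∪q∣+∣p∩q∣≡∣p∣+∣q∣ (inside  ∷ p) (outside ∷ q) = cong suc (∣p∪q∣+∣p∩q∣≡∣p∣+∣q∣ p q)
∣p∪q∣+∣p∩q∣≡∣p∣+∣q∣ (outside ∷ p) (inside  ∷ q) =
  trans (cong suc (∣p∪q∣+∣p∩q∣≡∣p∣+∣q∣ p q)) (sym (ℕ.+-suc ∣ p ∣ ∣ q ∣))
∣p∪q∣+∣p∩q∣≡∣p∣+∣q∣ (inside  ∷ p) (inside  ∷ q) = cong suc
  (trans (ℕ.+-suc ∣ p ∪ q ∣ ∣ p ∩ q ∣)
    (trans (cong suc (∣p∪q∣+∣p∩q∣≡∣p∣+∣q∣ p q)) (sym (ℕ.+-suc ∣ p ∣ ∣ q ∣))))

∣p∪q∣≤∣p∣+∣q∣ : (p q : Subset n) → ∣ p ∪ q ∣ ≤ ∣ p ∣ + ∣ q ∣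
∣p∪q∣≤∣p∣+∣q∣ p q = subst (∣ p ∪ q ∣ ≤_) (∣p∪q∣+∣p∩q∣≡∣p∣+∣q∣ p q) (ℕ.m≤m+n ∣ p ∪ q ∣ ∣ p ∩ q ∣)

disjoint⇒∣p∪q∣≡∣p∣+∣q∣ : (p q : Subset n) → (∀ {x} → x ∈ₛ p → x ∉ₛ q) → ∣ p ∪ q ∣ ≡ ∣ p ∣ + ∣ q ∣
disjoint⇒∣p∪q∣≡∣p∣+∣q∣ {n} p q disjoint = trans (sym (ℕ.+-identityʳ _)) (trans
  (cong (∣ p ∪ q ∣ +_) (sym ∣p∩q∣≡0))
  (∣p∪q∣+∣p∩q∣≡∣p∣+∣q∣ p q))
  where
  ∣p∩q∣≡0 : ∣ p ∩ q ∣ ≡ 0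
  ∣p∩q∣≡0 = trans
    (cong ∣_∣ (Empty-unique λ (x , x∈) → let x∈p , x∈q = x∈p∩q⁻ p q x∈ in disjoint x∈p x∈q))
    (∣⊥∣≡0 n)

∣p∣≤∣q∣∧q⊆p⇒p≡q : {p q : Subset n} → ∣ p ∣ ≤ ∣ q ∣ → q ⊆ p → p ≡ q
∣p∣≤∣q∣∧q⊆p⇒p≡q {p = p} {q} ∣p∣≤∣q∣ q⊆p = ⊆-antisym
  (λ {x} x∈p → decidable-stable (x ∈ₛ? q) λ x∉q →
    ℕ.<⇒≱ (p⊂q⇒∣p∣<∣q∣ (q⊆p , x , x∈p , x∉q)) ∣p∣≤∣q∣)
  q⊆p

∣⁅x⁆∪⁅y⁆∣≤2 : (x y : Fin n) → ∣ ⁅ x ⁆ ∪ ⁅ y ⁆ ∣ ≤ 2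
∣⁅x⁆∪⁅y⁆∣≤2 x y =
  subst (∣ ⁅ x ⁆ ∪ ⁅ y ⁆ ∣ ≤_) (cong₂ _+_ (∣⁅x⁆∣≡1 x) (∣⁅x⁆∣≡1 y)) (∣p∪q∣≤∣p∣+∣q∣ ⁅ x ⁆ ⁅ y ⁆)

∣⁅x⁆∪p∣ : {x : Fin n} {p : Subset n} → x ∉ₛ p → ∣ ⁅ x ⁆ ∪ p ∣ ≡ suc ∣ p ∣
∣⁅x⁆∪p∣ {x = x} {p} x∉p = trans
  (disjoint⇒∣p∪q∣≡∣p∣+∣q∣ ⁅ x ⁆ p (λ v∈ v∈p → x∉p (subst (_∈ₛ p) (x∈⁅y⁆⇒x≡y x v∈) v∈p)))
  (cong (_+ ∣ p ∣) (∣⁅x⁆∣≡1 x))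

∣p∣≤1⇒≡ : {p : Subset n} → ∣ p ∣ ≤ 1 → ∀ {x y} → x ∈ₛ p → y ∈ₛ p → x ≡ y
∣p∣≤1⇒≡ {p = p} ∣p∣≤1 {x} {y} x∈p y∈p = decidable-stable (x ≟ y) λ x≢y →
  ℕ.<⇒≱ (subst (_≤ ∣ p ∣) (∣pair∣ x≢y) (p⊆q⇒∣p∣≤∣q∣ pair⊆p)) ∣p∣≤1
  where
  ∣pair∣ : x ≢ y → ∣ ⁅ x ⁆ ∪ ⁅ y ⁆ ∣ ≡ 2
  ∣pair∣ x≢y = trans (∣⁅x⁆∪p∣ (x≢y ∘ x∈⁅y⁆⇒x≡y y)) (cong suc (∣⁅x⁆∣≡1 y))

  pair⊆p : ⁅ x ⁆ ∪ ⁅ y ⁆ ⊆ p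
  pair⊆p v∈ with x∈p∪q⁻ ⁅ x ⁆ ⁅ y ⁆ v∈
  ... | inj₁ v∈x = subst (_∈ₛ p) (sym (x∈⁅y⁆⇒x≡y x v∈x)) x∈p
  ... | inj₂ v∈y = subst (_∈ₛ p) (sym (x∈⁅y⁆⇒x≡y y v∈y)) y∈p

≡⇒∣p∣≤1 : (p : Subset n) → (∀ {x y} → x ∈ₛ p → y ∈ₛ p → x ≡ y) → ∣ p ∣ ≤ 1
≡⇒∣p∣≤1 {n} p p-prop with any? (_∈ₛ? p)
... | yes (x , x∈p) = subst (∣ p ∣ ≤_) (∣⁅x⁆∣≡1 x)
  (p⊆q⇒∣p∣≤∣q∣ λ v∈p → subst (_∈ₛ ⁅ x ⁆) (p-prop x∈p v∈p) (x∈⁅x⁆ x))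
... | no empty = subst (_≤ 1) (sym (trans (cong ∣_∣ (Empty-unique empty)) (∣⊥∣≡0 n))) z≤n

∣p∣≡suc⇒∃ : ∀ {k} {p : Subset n} → ∣ p ∣ ≡ suc k → ∃[ x ] x ∈ₛ p
∣p∣≡suc⇒∃ {n} {p = p} ∣p∣≡1+k with any? (_∈ₛ? p)
... | yes found = found
... | no empty  = contradiction
  (trans (sym ∣p∣≡1+k) (trans (cong ∣_∣ (Empty-unique empty)) (∣⊥∣≡0 n))) λ ()

∣p∣≡3⇒∃ : {p : Subset n} → ∣ p ∣ ≡ 3 → ∀ x y → ∃[ z ] z ∈ₛ p × z ≢ x × z ≢ y
∣p∣≡3⇒∃ {p = p} ∣p∣≡3 x y with any? (λ z → (z ∈ₛ? p) ×-dec (¬? (z ≟ x) ×-dec ¬? (z ≟ y)))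
... | yes found = found
... | no ¬found = contradiction
  (subst (_≤ 2) ∣p∣≡3 (ℕ.≤-trans (p⊆q⇒∣p∣≤∣q∣ p⊆) (∣⁅x⁆∪⁅y⁆∣≤2 x y)))
  (ℕ.<-irrefl refl)
  where
  p⊆ : p ⊆ ⁅ x ⁆ ∪ ⁅ y ⁆
  p⊆ {z} z∈p with z ≟ x | z ≟ y
  ... | yes refl | _        = x∈p∪q⁺ (inj₁ (x∈⁅x⁆ z))
  ... | no _     | yes refl = x∈p∪q⁺ (inj₂ (x∈⁅x⁆ z))
  ... | no z≢x   | no z≢y   = contradiction (z , z∈p , z≢x , z≢y) ¬found

-- Three-element sets as triples of vertices.

x∈triple : (x y z : Fin n) → x ∈ₛ triple x y z
x∈triple x y z = x∈p∪q⁺ (inj₁ (x∈⁅x⁆ x))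

y∈triple : (x y z : Fin n) → y ∈ₛ triple x y z
y∈triple x y z = x∈p∪q⁺ {p = ⁅ x ⁆} (inj₂ (x∈p∪q⁺ (inj₁ (x∈⁅x⁆ y))))

z∈triple : (x y z : Fin n) → z ∈ₛ triple x y z
z∈triple x y z = x∈p∪q⁺ {p = ⁅ x ⁆} (inj₂ (x∈p∪q⁺ {p = ⁅ y ⁆} (inj₂ (x∈⁅x⁆ z))))

∈triple⁻ : (x y z : Fin n) → ∀ {v} → v ∈ₛ triple x y z → v ≡ x ⊎ v ≡ y ⊎ v ≡ z
∈triple⁻ x y z v∈ with x∈p∪q⁻ ⁅ x ⁆ (⁅ y ⁆ ∪ ⁅ z ⁆) v∈
... | inj₁ v∈x = inj₁ (x∈⁅y⁆⇒x≡y x v∈x)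
... | inj₂ v∈yz with x∈p∪q⁻ ⁅ y ⁆ ⁅ z ⁆ v∈yz
...   | inj₁ v∈y = inj₂ (inj₁ (x∈⁅y⁆⇒x≡y y v∈y))
...   | inj₂ v∈z = inj₂ (inj₂ (x∈⁅y⁆⇒x≡y z v∈z))

triple-⊆ : {x y z : Fin n} {p : Subset n} → x ∈ₛ p → y ∈ₛ p → z ∈ₛ p → triple x y z ⊆ p
triple-⊆ {x = x} {y} {z} x∈p y∈p z∈p v∈ with ∈triple⁻ x y z v∈
... | inj₁ refl        = x∈p
... | inj₂ (inj₁ refl) = y∈p
... | inj₂ (inj₂ refl) = z∈p

triple-swap : (x y z : Fin n) → triple x y z ≡ triple y x z
triple-swap x y z = ⊆-antisym
  (triple-⊆ (y∈triple y x z) (x∈triple y x z) (z∈triple y x z))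
  (triple-⊆ (y∈triple x y z) (x∈triple x y z) (z∈triple x y z))

triple-rotate : (x y z : Fin n) → triple x y z ≡ triple y z x
triple-rotate x y z = ⊆-antisym
  (triple-⊆ (z∈triple y z x) (x∈triple y z x) (y∈triple y z x))
  (triple-⊆ (y∈triple x y z) (z∈triple x y z) (x∈triple x y z))

∣triple∣≡3 : {x y z : Fin n} → x ≢ y → x ≢ z → y ≢ z → ∣ triple x y z ∣ ≡ 3
∣triple∣≡3 {x = x} {y} {z} x≢y x≢z y≢z = trans
  (∣⁅x⁆∪p∣ λ x∈ → [ x≢y ∘ x∈⁅y⁆⇒x≡y y , x≢z ∘ x∈⁅y⁆⇒x≡y z ] (x∈p∪q⁻ ⁅ y ⁆ ⁅ z ⁆ x∈))
  (cong suc (trans (∣⁅x⁆∪p∣ (y≢z ∘ x∈⁅y⁆⇒x≡y z)) (cong suc (∣⁅x⁆∣≡1 z))))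

∣triple∣≡3⇒x≢y : (x y z : Fin n) → ∣ triple x y z ∣ ≡ 3 → x ≢ y
∣triple∣≡3⇒x≢y x y z eq refl with ∣p∣≡3⇒∃ eq x z
... | v , v∈ , v≢x , v≢z with ∈triple⁻ x x z v∈
...   | inj₁ v≡x        = v≢x v≡x
...   | inj₂ (inj₁ v≡x) = v≢x v≡x
...   | inj₂ (inj₂ v≡z) = v≢z v≡z

∣p∣≡3⇒triple : {p : Subset n} → ∣ p ∣ ≡ 3 → ∀ {x y z} → x ∈ₛ p → y ∈ₛ p → z ∈ₛ p →
  x ≢ y → x ≢ z → y ≢ z → p ≡ triple x y z
∣p∣≡3⇒triple ∣p∣≡3 x∈p y∈p z∈p x≢y x≢z y≢z = ∣p∣≤∣q∣∧q⊆p⇒p≡q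
  (ℕ.≤-reflexive (trans ∣p∣≡3 (sym (∣triple∣≡3 x≢y x≢z y≢z))))
  (triple-⊆ x∈p y∈p z∈p)

image-triple : (φ : Fin m → Fin n) (x y z : Fin m) → image φ (triple x y z) ≡ triple (φ x) (φ y) (φ z)
image-triple φ x y z = ⊆-antisym
  (λ v∈ → case ∈-tabulate⁻ image? v∈ of λ (u , u∈ , φu≡v) →
    subst (_∈ₛ triple (φ x) (φ y) (φ z)) φu≡v (φ∈ (∈triple⁻ x y z u∈)))
  (triple-⊆
    (∈-tabulate⁺ image? (x , x∈triple x y z , refl))
    (∈-tabulate⁺ image? (y , y∈triple x y z , refl))
    (∈-tabulate⁺ image? (z , z∈triple x y z , refl)))
  where
  image? = λ v → any? λ u → (u ∈ₛ? triple x y z) ×-dec (φ u ≟ v)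

  φ∈ : ∀ {u} → u ≡ x ⊎ u ≡ y ⊎ u ≡ z → φ u ∈ₛ triple (φ x) (φ y) (φ z)
  φ∈ (inj₁ refl)        = x∈triple _ _ _
  φ∈ (inj₂ (inj₁ refl)) = y∈triple (φ x) _ _
  φ∈ (inj₂ (inj₂ refl)) = z∈triple (φ x) (φ y) _

∣p∣≡3⇒vertices : {p : Subset n} → ∣ p ∣ ≡ 3 →
  ∃[ x ] ∃[ y ] ∃[ z ] x ∈ₛ p × y ∈ₛ p × z ∈ₛ p × x ≢ y × x ≢ z × y ≢ z
∣p∣≡3⇒vertices ∣p∣≡3 =
  let x , x∈p             = ∣p∣≡suc⇒∃ ∣p∣≡3
      y , y∈p , y≢x , _   = ∣p∣≡3⇒∃ ∣p∣≡3 x x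
      z , z∈p , z≢x , z≢y = ∣p∣≡3⇒∃ ∣p∣≡3 x y
  in x , y , z , x∈p , y∈p , z∈p , ≢-sym y≢x , ≢-sym z≢x , ≢-sym z≢y

-- Remove the witness `z` of the head from `p`: a later entry differs from `f z`, so its own witness
-- survives the removal. With `f` sending a vertex to the edge it completes, this bounds a co-degree
-- by the size of a link.
length≤∣p∣ : {A : Set} (f : Fin n → A) {as : List A} → Unique as → (p : Subset n) →
  All (λ a → ∃[ z ] z ∈ₛ p × a ≡ f z) as → length as ≤ ∣ p ∣
length≤∣p∣ f [] p [] = z≤n
length≤∣p∣ f (a∉as ∷ as-unique) p ((z , z∈p , refl) ∷ as⊆f[p]) = ℕ.≤-trans
  (s≤s (length≤∣p∣ f as-unique (p - z) (All.zipWith avoid (a∉as , as⊆f[p]))))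
  (x∈p⇒∣p-x∣<∣p∣ z∈p)
  where
  avoid : ∀ {a} → f z ≢ a × (∃[ w ] w ∈ₛ p × a ≡ f w) → ∃[ w ] w ∈ₛ p - z × a ≡ f w
  avoid (fz≢a , w , w∈p , a≡fw) =
    w , x∈p∧x≢y⇒x∈p-y w∈p (λ w≡z → fz≢a (trans (cong f (sym w≡z)) (sym a≡fw))) , a≡fw

-- Finite checks on four indices.

Distinct : Fin 4 → Fin 4 → Fin 4 → Fin 4 → Set
Distinct i j k l = Unique (i ∷ j ∷ k ∷ l ∷ [])

-- Each triple is written in the vertex order in which `edge⇒extremal` produces the corresponding
-- edge.
K₄-triples : List (Subset 4)
K₄-triples = triple 0F 1F 2F ∷ triple 0F 1F 3F ∷ triple 2F 3F 0F ∷ triple 2F 3F 1F ∷ []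

distinct? : ∀ i j k l → Dec (Distinct i j k l)
distinct? i j k l = allPairs? (λ i j → ¬? (i ≟ j)) (i ∷ j ∷ k ∷ l ∷ [])

-- abstract keeps the enumerations from being unfolded again wherever their results
-- are matched on.
abstract

  -- As sets, the 24 ordered triples of distinct indices are only four, so four edges of a 3-graph
  -- yield a `K₄` hypothesis that holds for every order of the indices.
  triple∈K₄-triples : ∀ i j k → i ≢ j → i ≢ k → j ≢ k → triple i j k ∈ K₄-triples
  triple∈K₄-triples = from-yes (all? λ i → all? λ j → all? λ k →
    ¬? (i ≟ j) →-dec (¬? (i ≟ k) →-dec (¬? (j ≟ k) →-dec (triple i j k ∈? K₄-triples))))

  two-others : ∀ (i : Fin 4) → ∃[ j ] ∃[ k ] i ≢ j × i ≢ k × j ≢ k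
  two-others = from-yes (all? λ (i : Fin 4) → any? λ j → any? λ k → ¬? (i ≟ j) ×-dec (¬? (i ≟ k) ×-dec ¬? (j ≟ k)))

  third-index : ∀ (i j : Fin 4) → ∃[ k ] i ≢ k × j ≢ k
  third-index = from-yes (all? λ (i : Fin 4) → all? λ j → any? λ k → ¬? (i ≟ k) ×-dec ¬? (j ≟ k))

  fourth-index : ∀ (i j k : Fin 4) → i ≢ j → i ≢ k → j ≢ k → ∃[ l ] Distinct i j k l
  fourth-index = from-yes (all? λ i → all? λ j → all? λ k →
    ¬? (i ≟ j) →-dec (¬? (i ≟ k) →-dec (¬? (j ≟ k) →-dec any? (distinct? i j k))))

  complementary-pair : ∀ (i j : Fin 4) → i ≢ j → ∃[ k ] ∃[ l ] Distinct i j k l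
  complementary-pair = from-yes (all? λ i → all? λ j → ¬? (i ≟ j) →-dec (any? λ k → any? (distinct? i j k)))

  one-of-four : ∀ {i j k l} → Distinct i j k l → ∀ c → c ≢ k → c ≢ l → c ≡ i ⊎ c ≡ j
  one-of-four {i} {j} {k} {l} = from-yes (all? λ i → all? λ j → all? λ k → all? λ l →
    distinct? i j k l →-dec (all? λ c → ¬? (c ≟ k) →-dec (¬? (c ≟ l) →-dec ((c ≟ i) ⊎-dec (c ≟ j))))) i j k l

-- Edges as ordered triples, links, and co-degrees.

module _ (H : ThreeGraph n) where

  -- Since `triple` is a set, reordering the arguments is an equality of subsets (`swap`, `rotate`).
  -- Distinctness of the vertices is built in: an edge has three elements.
  Edge : Fin n → Fin n → Fin n → Set
  Edge x y z = triple x y z ∈ edges H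

  edge? : ∀ x y z → Dec (Edge x y z)
  edge? x y z = triple x y z ∈? edges H

  -- This is the set denoted N(x, y).
  link : Fin n → Fin n → Subset n
  link x y = tabulate (does ∘ edge? x y)

module _ {H : ThreeGraph n} where

  ∣edge∣≡3 : ∀ {e} → e ∈ edges H → ∣ e ∣ ≡ 3
  ∣edge∣≡3 = All.lookup (uniform H)

  swap : ∀ {x y z} → Edge H x y z → Edge H y x z
  swap {x} {y} {z} = subst (_∈ edges H) (triple-swap x y z)

  rotate : ∀ {x y z} → Edge H x y z → Edge H y z x
  rotate {x} {y} {z} = subst (_∈ edges H) (triple-rotate x y z)

  edge⇒x≢y : ∀ {x y z} → Edge H x y z → x ≢ y
  edge⇒x≢y {x} {y} {z} e = ∣triple∣≡3⇒x≢y x y z (∣edge∣≡3 e)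

  edge⇒y≢z : ∀ {x y z} → Edge H x y z → y ≢ z
  edge⇒y≢z = edge⇒x≢y ∘ rotate

  edge⇒x≢z : ∀ {x y z} → Edge H x y z → x ≢ z
  edge⇒x≢z = ≢-sym ∘ edge⇒y≢z ∘ rotate

  -- An edge containing `x` and `y` is `triple x y z` for its remaining vertex `z`, which lies in
  -- the link; distinct edges have distinct remaining vertices.
  codegree≤∣link∣ : ∀ {x y} → x ≢ y → codegree H x y ≤ ∣ link H x y ∣
  codegree≤∣link∣ {x} {y} x≢y = length≤∣p∣ (triple x y)
    (Unique-filter⁺ (hasPair? x y) (unique H)) (link H x y)
    (All.tabulate λ e∈ → third (∈-filter⁻ (hasPair? x y) {xs = edges H} e∈))
    where
    third : ∀ {e} → e ∈ edges H × HasPair x y e → ∃[ z ] z ∈ₛ link H x y × e ≡ triple x y z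
    third (e∈H , x∈e , y∈e) =
      let z , z∈e , z≢x , z≢y = ∣p∣≡3⇒∃ (∣edge∣≡3 e∈H) x y
          e≡xyz = ∣p∣≡3⇒triple (∣edge∣≡3 e∈H) x∈e y∈e z∈e x≢y (≢-sym z≢x) (≢-sym z≢y)
      in z , ∈-tabulate⁺ (edge? H x y) (subst (_∈ edges H) e≡xyz e∈H) , e≡xyz

  δ₂⁺≤∣link∣ : ∀ {x y z} → Edge H x y z → δ₂⁺ H ≤ ∣ link H x y ∣
  δ₂⁺≤∣link∣ {x} {y} {z} e = ℕ.≤-trans
    (δ₂⁺-attained H x y (edge⇒x≢y e) (lose e (x∈triple x y z , y∈triple x y z)))
    (codegree≤∣link∣ (edge⇒x≢y e))

  edge-or-δ₂⁺≡0 : (∃[ x ] ∃[ y ] ∃[ z ] Edge H x y z) ⊎ δ₂⁺ H ≡ 0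
  edge-or-δ₂⁺≡0 = go (edges H) refl
    where
    go : ∀ es → edges H ≡ es → (∃[ x ] ∃[ y ] ∃[ z ] Edge H x y z) ⊎ δ₂⁺ H ≡ 0
    go []      eq = inj₂ (δ₂⁺-empty H eq)
    go (e ∷ _) eq =
      let e∈H = subst (e ∈_) (sym eq) (here refl)
          x , y , z , x∈e , y∈e , z∈e , x≢y , x≢z , y≢z = ∣p∣≡3⇒vertices (∣edge∣≡3 e∈H)
      in inj₁ (x , y , z , subst (_∈ edges H) (∣p∣≡3⇒triple (∣edge∣≡3 e∈H) x∈e y∈e z∈e x≢y x≢z y≢z) e∈H)

  -- Independence of links and the bound n/2.

  module _ (free : (F₃,₂ -Free) H) where

    -- Sending 1, 2, 3 to `a`, `b`, `c` and 4, 5 to `p`, `q` would embed `F₃,₂`. Injectivity is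
    -- automatic, because any two of the five vertices lie in one of the four edges.
    link-independent : ∀ {p q a b c} → Edge H p q a → Edge H p q b → Edge H p q c → ¬ Edge H a b c
    link-independent {p} {q} {a} {b} {c} pqa pqb pqc abc = free (φ , injective ,
      at 0F 1F 2F abc ∷ at 0F 3F 4F (rotate (rotate pqa)) ∷
      at 1F 3F 4F (rotate (rotate pqb)) ∷ at 2F 3F 4F (rotate (rotate pqc)) ∷ [])
      where
      φ : Fin 5 → Fin n
      φ 0F = a
      φ 1F = b
      φ 2F = c
      φ 3F = p
      φ 4F = q

      at : ∀ i j k → Edge H (φ i) (φ j) (φ k) → image φ (triple i j k) ∈ edges H
      at i j k = subst (_∈ edges H) (sym (image-triple φ i j k))

      injective : ∀ {i j} → φ i ≡ φ j → i ≡ j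
      injective {0F} {0F} _ = refl
      injective {1F} {1F} _ = refl
      injective {2F} {2F} _ = refl
      injective {3F} {3F} _ = refl
      injective {4F} {4F} _ = refl
      injective {0F} {1F} eq = contradiction eq (edge⇒x≢y abc)
      injective {0F} {2F} eq = contradiction eq (edge⇒x≢z abc)
      injective {1F} {2F} eq = contradiction eq (edge⇒y≢z abc)
      injective {1F} {0F} eq = contradiction (sym eq) (edge⇒x≢y abc)
      injective {2F} {0F} eq = contradiction (sym eq) (edge⇒x≢z abc)
      injective {2F} {1F} eq = contradiction (sym eq) (edge⇒y≢z abc)
      injective {3F} {0F} eq = contradiction eq (edge⇒x≢z pqa)
      injective {3F} {1F} eq = contradiction eq (edge⇒x≢z pqb)
      injective {3F} {2F} eq = contradiction eq (edge⇒x≢z pqc)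
      injective {3F} {4F} eq = contradiction eq (edge⇒x≢y pqa)
      injective {4F} {0F} eq = contradiction eq (edge⇒y≢z pqa)
      injective {4F} {1F} eq = contradiction eq (edge⇒y≢z pqb)
      injective {4F} {2F} eq = contradiction eq (edge⇒y≢z pqc)
      injective {4F} {3F} eq = contradiction (sym eq) (edge⇒x≢y pqa)
      injective {0F} {3F} eq = contradiction (sym eq) (edge⇒x≢z pqa)
      injective {0F} {4F} eq = contradiction (sym eq) (edge⇒y≢z pqa)
      injective {1F} {3F} eq = contradiction (sym eq) (edge⇒x≢z pqb)
      injective {1F} {4F} eq = contradiction (sym eq) (edge⇒y≢z pqb)
      injective {2F} {3F} eq = contradiction (sym eq) (edge⇒x≢z pqc)
      injective {2F} {4F} eq = contradiction (sym eq) (edge⇒y≢z pqc)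

    -- The vertex `c` only witnesses that the pair `a`, `b` of N(p, q) has positive co-degree.
    InnerPair : Fin n → Fin n → Set
    InnerPair p q = ∃[ a ] ∃[ b ] ∃[ c ] Edge H p q a × Edge H p q b × Edge H a b c

    -- A common vertex `v` of N(p, q) and N(p, z) makes `z`, `v` an inner pair of N(p, q), since the
    -- edge `p z v` contains both.
    innerPair⊎disjoint : ∀ {p q z} → Edge H p q z →
      InnerPair p q ⊎ (∀ {v} → Edge H p q v → ¬ Edge H p z v)
    innerPair⊎disjoint {p} {q} {z} pqz
      with any? (λ a → any? λ b → any? λ c → edge? H p q a ×-dec (edge? H p q b ×-dec edge? H a b c))
    ... | yes inner = inj₁ inner
    ... | no ¬inner = inj₂ λ {v} pqv pzv → ¬inner (z , v , p , pqz , pqv , rotate pzv)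

    ∣link∪link∣ : ∀ {p q a b} → (∀ {v} → Edge H p q v → ¬ Edge H a b v) →
      ∣ link H p q ∪ link H a b ∣ ≡ ∣ link H p q ∣ + ∣ link H a b ∣
    ∣link∪link∣ {p} {q} {a} {b} disjoint = disjoint⇒∣p∪q∣≡∣p∣+∣q∣ (link H p q) (link H a b)
      λ v∈pq v∈ab → disjoint (∈-tabulate⁻ (edge? H p q) v∈pq) (∈-tabulate⁻ (edge? H a b) v∈ab)

    ∣link∣+∣link∣≤n : ∀ {p q a b} → (∀ {v} → Edge H p q v → ¬ Edge H a b v) →
      ∣ link H p q ∣ + ∣ link H a b ∣ ≤ n
    ∣link∣+∣link∣≤n {p} {q} {a} {b} disjoint =
      subst (_≤ n) (∣link∪link∣ disjoint) (∣p∣≤n (link H p q ∪ link H a b))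

    disjoint-links⇒2δ₂⁺≤n : ∀ {p q z a b c} → Edge H p q z → Edge H a b c →
      (∀ {v} → Edge H p q v → ¬ Edge H a b v) → δ₂⁺ H + δ₂⁺ H ≤ n
    disjoint-links⇒2δ₂⁺≤n pqz abc disjoint = ℕ.≤-trans
      (ℕ.+-mono-≤ (δ₂⁺≤∣link∣ pqz) (δ₂⁺≤∣link∣ abc)) (∣link∣+∣link∣≤n disjoint)

    2δ₂⁺≤n : δ₂⁺ H + δ₂⁺ H ≤ n
    2δ₂⁺≤n with edge-or-δ₂⁺≡0
    ... | inj₂ δ≡0 = subst (λ k → k + k ≤ n) (sym δ≡0) z≤n
    ... | inj₁ (p , q , z , pqz) with innerPair⊎disjoint pqz
    ...   | inj₁ (_ , _ , _ , pqa , pqb , abc) =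
      disjoint-links⇒2δ₂⁺≤n pqz abc λ pqv → link-independent pqa pqb pqv
    -- The edge is reordered to `p z q`, so that it witnesses positive co-degree of the pair `p`,
    -- `z`.
    ...   | inj₂ disjoint =
      disjoint-links⇒2δ₂⁺≤n pqz (swap (rotate (rotate pqz))) disjoint

    -- The equality case: links as cuts of the vertex set.

    module _ (tight : δ₂⁺ H + δ₂⁺ H ≡ n) where

      -- Each link has at least `δ₂⁺ H` vertices, so two disjoint ones already account for all `n`;
      -- a vertex outside both would make the union too small.
      disjoint⇒complement : ∀ {p q z a b c} → Edge H p q z → Edge H a b c →
        (∀ {v} → Edge H p q v → ¬ Edge H a b v) → ∀ {v} → ¬ Edge H p q v → Edge H a b v
      disjoint⇒complement {p} {q} {_} {a} {b} pqz abc disjoint {v} ¬pqv =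
        decidable-stable (edge? H a b v) λ ¬abv → ℕ.<⇒≱ (∣∪∣<n ¬abv) n≤∣∪∣
        where
        ∣∪∣<n : ¬ Edge H a b v → ∣ link H p q ∪ link H a b ∣ < n
        ∣∪∣<n ¬abv = subst (∣ link H p q ∪ link H a b ∣ <_) (∣⊤∣≡n n) (p⊂q⇒∣p∣<∣q∣ (⊆⊤ , v , ∈⊤ , λ v∈ →
          [ ¬pqv ∘ ∈-tabulate⁻ (edge? H p q) , ¬abv ∘ ∈-tabulate⁻ (edge? H a b) ]
            (x∈p∪q⁻ (link H p q) (link H a b) v∈)))

        n≤∣∪∣ : n ≤ ∣ link H p q ∪ link H a b ∣
        n≤∣∪∣ = subst₂ _≤_ tight (sym (∣link∪link∣ disjoint))
          (ℕ.+-mono-≤ (δ₂⁺≤∣link∣ pqz) (δ₂⁺≤∣link∣ abc))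

      innerPair : ∀ {p q z} → Edge H p q z → InnerPair p q
      innerPair {p} {q} {z} pqz with innerPair⊎disjoint pqz
      ... | inj₁ inner    = inner
      ... | inj₂ disjoint = contradiction refl (edge⇒x≢z
        (disjoint⇒complement pqz (swap (rotate (rotate pqz))) disjoint {p} λ pqp → edge⇒x≢z pqp refl))

      -- The link of an inner pair is disjoint from N(p, q) and takes up at least `δ₂⁺ H` vertices,
      -- which leaves at most `δ₂⁺ H` for N(p, q).
      ∣link∣≡δ₂⁺ : ∀ {p q z} → Edge H p q z → ∣ link H p q ∣ ≡ δ₂⁺ H
      ∣link∣≡δ₂⁺ {p} {q} pqz =
        let a , b , c , pqa , pqb , abc = innerPair pqz in
        ℕ.≤-antisym
          (ℕ.+-cancelʳ-≤ (δ₂⁺ H) _ _ (ℕ.≤-trans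
            (ℕ.+-monoʳ-≤ ∣ link H p q ∣ (δ₂⁺≤∣link∣ abc))
            (subst (∣ link H p q ∣ + ∣ link H a b ∣ ≤_) (sym tight)
              (∣link∣+∣link∣≤n λ pqv → link-independent pqa pqb pqv))))
          (δ₂⁺≤∣link∣ pqz)

      pair-in-link : ∀ {p q u v t} → Edge H p q u → Edge H p q v → Edge H u v t →
        ∀ {s} → ¬ Edge H p q s → Edge H u v s
      pair-in-link pqu pqv uvt =
        disjoint⇒complement pqu uvt λ pqs → link-independent pqu pqv pqs

      -- Take complements twice. An inner pair `a`, `b` of N(p, q) has the complement of N(p, q) as
      -- its link. That link contains `u` and `v`, so N(u, v) is in turn the complement of N(a, b),
      -- which is N(p, q).
      pair-off-link : ∀ {p q z u v t} → Edge H p q z → ¬ Edge H p q u → ¬ Edge H p q v → Edge H u v t →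
        ∀ {s} → Edge H p q s ⇔ Edge H u v s
      pair-off-link {p} {q} pqz ¬pqu ¬pqv uvt {s} =
        let a , b , c , pqa , pqb , abc = innerPair pqz
            abu = pair-in-link pqa pqb abc ¬pqu
            abv = pair-in-link pqa pqb abc ¬pqv
        in mk⇔
          (λ pqs → pair-in-link abu abv uvt (link-independent pqa pqb pqs))
          (λ uvs → decidable-stable (edge? H p q s) λ ¬pqs →
            link-independent abu abv (pair-in-link pqa pqb abc ¬pqs) uvs)

      -- The four classes determined by a K₄.

      module _ (r : Fin 4 → Fin n) (K₄ : ∀ i j k → i ≢ j → i ≢ k → j ≢ k → Edge H (r i) (r j) (r k)) where

        cuts-exclusive : ∀ {i j k l} → Distinct i j k l → ∀ {v} → Edge H (r i) (r j) v → ¬ Edge H (r k) (r l) v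
        cuts-exclusive {i} {j} {k} {l} ((i≢j ∷ i≢k ∷ i≢l ∷ []) ∷ (j≢k ∷ j≢l ∷ []) ∷ _) ijv =
          link-independent (K₄ i j k i≢j i≢k j≢k) (K₄ i j l i≢j i≢l j≢l) ijv

        cuts-cover : ∀ {i j k l} → Distinct i j k l → ∀ {v} → ¬ Edge H (r i) (r j) v → Edge H (r k) (r l) v
        cuts-cover {i} {j} {k} {l} ((i≢j ∷ i≢k ∷ i≢l ∷ []) ∷ (j≢k ∷ j≢l ∷ []) ∷ (k≢l ∷ []) ∷ _) =
          pair-in-link (K₄ i j k i≢j i≢k j≢k) (K₄ i j l i≢j i≢l j≢l)
            (K₄ k l i k≢l (≢-sym i≢k) (≢-sym i≢l))

        -- Otherwise the link of `r i` and `v` would contain `r j`, `r k`, `r l`, which form an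
        -- edge.
        no-K₅⁻ : ∀ {i j k l} → Distinct i j k l → ∀ {v} →
          Edge H (r i) (r j) v → Edge H (r i) (r k) v → ¬ Edge H (r i) (r l) v
        no-K₅⁻ {i} {j} {k} {l} (_ ∷ (j≢k ∷ j≢l ∷ []) ∷ (k≢l ∷ []) ∷ _) ijv ikv ilv =
          link-independent (to-link ijv) (to-link ikv) (to-link ilv) (K₄ j k l j≢k j≢l k≢l)
          where
          to-link : ∀ {j v} → Edge H (r i) (r j) v → Edge H (r i) v (r j)
          to-link = swap ∘ rotate ∘ rotate

        HasColour : Fin n → Fin 4 → Set
        HasColour v c = ∀ i → c ≢ i → ¬ Edge H (r c) (r i) v

        -- v lies in an even number of N(r₀, r₁), N(r₀, r₂), N(r₀, r₃): otherwise, as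
        -- the cuts are complementary in pairs, some rᵢ would have v in all three of
        -- its links.
        hasColour : ∀ v → ∃ (HasColour v)
        hasColour v with edge? H (r 0F) (r 1F) v | edge? H (r 0F) (r 2F) v | edge? H (r 0F) (r 3F) v
        ... | no ¬a | no ¬b | no ¬c = 0F , λ where
          0F 0≢0 → contradiction refl 0≢0
          1F _   → ¬a
          2F _   → ¬b
          3F _   → ¬c
        ... | no ¬a | yes b | yes c = 1F , λ where
          0F _   → ¬a ∘ swap
          1F 1≢1 → contradiction refl 1≢1
          2F _   → cuts-exclusive (from-yes (distinct? 0F 3F 1F 2F)) c
          3F _   → cuts-exclusive (from-yes (distinct? 0F 2F 1F 3F)) b
        ... | yes a | no ¬b | yes c = 2F , λ where
          0F _   → ¬b ∘ swap
          1F _   → cuts-exclusive (from-yes (distinct? 0F 3F 2F 1F)) c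
          2F 2≢2 → contradiction refl 2≢2
          3F _   → cuts-exclusive (from-yes (distinct? 0F 1F 2F 3F)) a
        ... | yes a | yes b | no ¬c = 3F , λ where
          0F _   → ¬c ∘ swap
          1F _   → cuts-exclusive (from-yes (distinct? 0F 2F 3F 1F)) b
          2F _   → cuts-exclusive (from-yes (distinct? 0F 1F 3F 2F)) a
          3F 3≢3 → contradiction refl 3≢3
        ... | yes a | yes b | yes c = contradiction c (no-K₅⁻ (from-yes (distinct? 0F 1F 2F 3F)) a b)
        ... | yes a | no ¬b | no ¬c = contradiction
          (cuts-cover (from-yes (distinct? 0F 2F 1F 3F)) ¬b)
          (no-K₅⁻ (from-yes (distinct? 1F 0F 2F 3F)) (swap a) (cuts-cover (from-yes (distinct? 0F 3F 1F 2F)) ¬c))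
        ... | no ¬a | yes b | no ¬c = contradiction
          (cuts-cover (from-yes (distinct? 0F 1F 2F 3F)) ¬a)
          (no-K₅⁻ (from-yes (distinct? 2F 0F 1F 3F)) (swap b) (cuts-cover (from-yes (distinct? 0F 3F 2F 1F)) ¬c))
        ... | no ¬a | no ¬b | yes c = contradiction
          (cuts-cover (from-yes (distinct? 0F 1F 3F 2F)) ¬a)
          (no-K₅⁻ (from-yes (distinct? 3F 0F 1F 2F)) (swap c) (cuts-cover (from-yes (distinct? 0F 2F 3F 1F)) ¬b))

        colour : Fin n → Fin 4
        colour = proj₁ ∘ hasColour

        ∉link-own : ∀ {v c} → colour v ≡ c → ∀ {i} → c ≢ i → ¬ Edge H (r c) (r i) v
        ∉link-own {v} refl {i} = proj₂ (hasColour v) i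

        -- With `m` the remaining index, `v` avoids the link of `r c` and `r m`, whose complement is
        -- the link of `r i` and `r j`.
        ∈link-others : ∀ {v c} → colour v ≡ c → ∀ {i j} → c ≢ i → c ≢ j → i ≢ j → Edge H (r i) (r j) v
        ∈link-others {c = c} v∈c {i} {j} c≢i c≢j i≢j with fourth-index i j c i≢j (≢-sym c≢i) (≢-sym c≢j)
        ... | m , (_ ∷ i≢c ∷ i≢m ∷ []) ∷ (j≢c ∷ j≢m ∷ []) ∷ (c≢m ∷ []) ∷ _ = cuts-cover
          ((c≢m ∷ c≢i ∷ c≢j ∷ []) ∷ (≢-sym i≢m ∷ ≢-sym j≢m ∷ []) ∷ (i≢j ∷ []) ∷ [] ∷ [])
          (∉link-own v∈c c≢m)

        -- If `u` and `v` share the colour `c`, both avoid the links of `r c`, `r i` and of `r c`,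
        -- `r j`, so `pair-off-link` identifies each of these links with N(u, v). But `r j` lies in
        -- the first and not in the second.
        proper : ∀ {u v t} → Edge H u v t → colour u ≢ colour v
        proper {u} {v} uvt cu≡cv with two-others (colour v)
        ... | i , j , c≢i , c≢j , i≢j = edge⇒y≢z
          (Equivalence.from (cut c≢j (≢-sym i≢j) c≢i) (Equivalence.to (cut c≢i i≢j c≢j) (K₄ _ i j c≢i c≢j i≢j)))
          refl
          where
          cut : ∀ {i j s} → colour v ≢ i → i ≢ j → colour v ≢ j → Edge H (r (colour v)) (r i) s ⇔ Edge H u v s
          cut c≢i i≢j c≢j = pair-off-link (K₄ _ _ _ c≢i c≢j i≢j) (∉link-own cu≡cv c≢i) (∉link-own refl c≢i) uvt

        -- Let a, b, c be the colours of `u`, `v`, `t`, and write r_a, r_b, r_c for the matching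
        -- vertices of the K₄. The vertices of the K₄ are exchanged in two steps. The pair `u`, r_c
        -- has the same link as r_a, r_c, and this contains `v`. The resulting edge gives the pair
        -- `u`, `v` positive co-degree, so N(u, v) is the link of r_a, r_b, and this contains `t`.
        complete : ∀ {u v t} → colour u ≢ colour v → colour u ≢ colour t → colour v ≢ colour t → Edge H u v t
        complete {u} {v} {t} a≢b a≢c b≢c with fourth-index _ _ _ a≢b a≢c b≢c
        ... | l , (_ ∷ _ ∷ a≢l ∷ []) ∷ (_ ∷ b≢l ∷ []) ∷ (c≢l ∷ []) ∷ _ = Equivalence.to
          (pair-off-link (K₄ _ _ l a≢b a≢l b≢l) (∉link-own refl a≢b) (∉link-own refl (≢-sym a≢b) ∘ swap) uvrc)
          (∈link-others refl (≢-sym a≢c) (≢-sym b≢c) a≢b)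
          where
          uvrc : Edge H u v (r (colour t))
          uvrc = swap (rotate (rotate (Equivalence.to
            (pair-off-link (K₄ _ _ l a≢c a≢l c≢l) (∉link-own refl a≢c) (λ e → edge⇒y≢z e refl)
              -- The fourth vertex `r l` supplies the edge showing that `u` and `r (colour t)` have
              -- positive co-degree.
              (rotate (rotate (∈link-others refl a≢c a≢l c≢l))))
            (∈link-others refl (≢-sym a≢b) b≢c a≢c))))

        -- Class sizes and divisibility by 4.

        ∈class⁻ : ∀ {i v} → v ∈ₛ class colour i → colour v ≡ i
        ∈class⁻ {i} = ∈-tabulate⁻ λ v → colour v ≟ i

        ∈class⁺ : ∀ {i v} → colour v ≡ i → v ∈ₛ class colour i
        ∈class⁺ {i} = ∈-tabulate⁺ λ v → colour v ≟ i

        -- The union of two classes is exactly the link of the two vertices `r k`, `r l` of the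
        -- other colours, and all links of edges have the same size.
        ∣class∣+∣class∣≡δ₂⁺ : ∀ {i j} → i ≢ j → ∣ class colour i ∣ + ∣ class colour j ∣ ≡ δ₂⁺ H
        ∣class∣+∣class∣≡δ₂⁺ {i} {j} i≢j with complementary-pair i j i≢j
        ... | k , l , ijkl@((_ ∷ i≢k ∷ i≢l ∷ []) ∷ (j≢k ∷ j≢l ∷ []) ∷ (k≢l ∷ []) ∷ _) = trans
          (sym (disjoint⇒∣p∪q∣≡∣p∣+∣q∣ (class colour i) (class colour j)
            λ v∈i v∈j → i≢j (trans (sym (∈class⁻ v∈i)) (∈class⁻ v∈j))))
          (trans (cong ∣_∣ (⊆-antisym ⊆link link⊆))
            (∣link∣≡δ₂⁺ (K₄ k l i k≢l (≢-sym i≢k) (≢-sym i≢l))))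
          where
          ⊆link : class colour i ∪ class colour j ⊆ link H (r k) (r l)
          ⊆link v∈ = ∈-tabulate⁺ (edge? H (r k) (r l))
            ([ (λ v∈i → ∈link-others (∈class⁻ v∈i) i≢k i≢l k≢l) , (λ v∈j → ∈link-others (∈class⁻ v∈j) j≢k j≢l k≢l) ]
              (x∈p∪q⁻ (class colour i) (class colour j) v∈))

          link⊆ : link H (r k) (r l) ⊆ class colour i ∪ class colour j
          link⊆ {v} v∈ =
            let klv = ∈-tabulate⁻ (edge? H (r k) (r l)) v∈ in
            [ (λ c≡i → x∈p∪q⁺ (inj₁ (∈class⁺ c≡i))) , (λ c≡j → x∈p∪q⁺ {p = class colour i} (inj₂ (∈class⁺ c≡j))) ]
              (one-of-four ijkl (colour v)
                (λ c≡k → ∉link-own c≡k k≢l klv)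
                (λ c≡l → ∉link-own c≡l (≢-sym k≢l) (swap klv)))

        -- Both classes have the same total with a third class `k`, which cancels.
        ∣class∣≡∣class∣ : ∀ i j → ∣ class colour i ∣ ≡ ∣ class colour j ∣
        ∣class∣≡∣class∣ i j =
          let k , i≢k , j≢k = third-index i j in
          ℕ.+-cancelʳ-≡ ∣ class colour k ∣ _ _
            (trans (∣class∣+∣class∣≡δ₂⁺ i≢k) (sym (∣class∣+∣class∣≡δ₂⁺ j≢k)))

        4∣n : 4 ∣ n
        4∣n = divides s (trans (sym tight) (trans (cong (λ k → k + k) δ≡s+s) ([s+s]+[s+s]≡s*4 s)))
          where
          s = ∣ class colour 0F ∣

          δ≡s+s : δ₂⁺ H ≡ s + s
          δ≡s+s = trans (sym (∣class∣+∣class∣≡δ₂⁺ {0F} {1F} λ ())) (cong (s +_) (∣class∣≡∣class∣ 1F 0F))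

          [s+s]+[s+s]≡s*4 : ∀ s → (s + s) + (s + s) ≡ s * 4
          [s+s]+[s+s]≡s*4 = solve-∀

        -- The edges are exactly the transversal triples.

        edge⇒∣e∩class∣≤1 : ∀ {e} → e ∈ edges H → ∀ i → ∣ e ∩ class colour i ∣ ≤ 1
        edge⇒∣e∩class∣≤1 {e} e∈H i = ≡⇒∣p∣≤1 (e ∩ class colour i) λ {u} {v} u∈ v∈ →
          let u∈e , u∈i = x∈p∩q⁻ e (class colour i) u∈
              v∈e , v∈i = x∈p∩q⁻ e (class colour i) v∈
          in decidable-stable (u ≟ v) λ u≢v →
            let t , t∈e , t≢u , t≢v = ∣p∣≡3⇒∃ (∣edge∣≡3 e∈H) u v
                e≡uvt = ∣p∣≡3⇒triple (∣edge∣≡3 e∈H) u∈e v∈e t∈e u≢v (≢-sym t≢u) (≢-sym t≢v)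
            in proper (subst (_∈ edges H) e≡uvt e∈H) (trans (∈class⁻ u∈i) (sym (∈class⁻ v∈i)))

        transversal⇒edge : ∀ {e} → ∣ e ∣ ≡ 3 → (∀ i → ∣ e ∩ class colour i ∣ ≤ 1) → e ∈ edges H
        transversal⇒edge {e} ∣e∣≡3 ∣e∩class∣≤1 =
          let x , y , z , x∈e , y∈e , z∈e , x≢y , x≢z , y≢z = ∣p∣≡3⇒vertices ∣e∣≡3 in
          subst (_∈ edges H) (sym (∣p∣≡3⇒triple ∣e∣≡3 x∈e y∈e z∈e x≢y x≢z y≢z))
            (complete (distinct-colours x∈e y∈e x≢y) (distinct-colours x∈e z∈e x≢z) (distinct-colours y∈e z∈e y≢z))
          where
          distinct-colours : ∀ {u v} → u ∈ₛ e → v ∈ₛ e → u ≢ v → colour u ≢ colour v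
          distinct-colours u∈e v∈e u≢v cu≡cv = u≢v (∣p∣≤1⇒≡ (∣e∩class∣≤1 _)
            (x∈p∩q⁺ (u∈e , ∈class⁺ cu≡cv)) (x∈p∩q⁺ (v∈e , ∈class⁺ refl)))

        completeBalanced4Partite : IsCompleteBalanced4Partite H
        completeBalanced4Partite = record
          { colour   = colour
          ; balanced = λ i j → ℕ.m≤n⇒m≤1+n (ℕ.≤-reflexive (∣class∣≡∣class∣ i j))
          ; complete = λ e → mk⇔
              (λ e∈H → ∣edge∣≡3 e∈H , edge⇒∣e∩class∣≤1 e∈H)
              (λ (∣e∣≡3 , ∣e∩class∣≤1) → transversal⇒edge ∣e∣≡3 ∣e∩class∣≤1)
          }

      -- Construction of a K₄ from an edge.

      edge⇒extremal : ∀ {x y z} → Edge H x y z → (4 ∣ n) × IsCompleteBalanced4Partite H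
      edge⇒extremal {x} {y} xyz with innerPair xyz
      ... | a , b , c , xya , xyb , abc = 4∣n r K₄ , completeBalanced4Partite r K₄
        where
        r : Fin 4 → Fin n
        r 0F = x
        r 1F = y
        r 2F = a
        r 3F = b

        at : ∀ i j k → Edge H (r i) (r j) (r k) → image r (triple i j k) ∈ edges H
        at i j k = subst (_∈ edges H) (sym (image-triple r i j k))

        K₄-images : All (λ e → image r e ∈ edges H) K₄-triples
        K₄-images = at 0F 1F 2F xya ∷ at 0F 1F 3F xyb ∷
          -- Neither `x` nor `y` lies in N(x, y), so both lie in its complement N(a, b).
          at 2F 3F 0F (pair-in-link xya xyb abc λ xyx → edge⇒x≢z xyx refl) ∷
          at 2F 3F 1F (pair-in-link xya xyb abc λ xyy → edge⇒y≢z xyy refl) ∷ []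

        K₄ : ∀ i j k → i ≢ j → i ≢ k → j ≢ k → Edge H (r i) (r j) (r k)
        K₄ i j k i≢j i≢k j≢k = subst (_∈ edges H) (image-triple r i j k)
          (All.lookup K₄-images (triple∈K₄-triples i j k i≢j i≢k j≢k))

-- The extremal number and the extremal 3-graphs.

2*k≡k+k : ∀ k → 2 * k ≡ k + k
2*k≡k+k k = cong (k +_) (ℕ.+-identityʳ k)

theorem8 : (n : ℕ) → .{{_ : NonZero n}} →
    (2 * co⁺ex n F₃,₂ ≤ n) ×
    ((H : ThreeGraph n) → (F₃,₂ -Free) H → 2 * δ₂⁺ H ≡ n →
    (4 ∣ n) × IsCompleteBalanced4Partite H)
theorem8 n = bound , extremal
  where
  bound : 2 * co⁺ex n F₃,₂ ≤ n
  bound =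
    -- The maximum is attained because `F₃,₂` has edges, so bounding each single free 3-graph
    -- suffices.
    let H , free , δ≡ = co⁺ex-attained n F₃,₂ λ ()
    in subst (λ k → 2 * k ≤ n) δ≡ (subst (_≤ n) (sym (2*k≡k+k (δ₂⁺ H))) (2δ₂⁺≤n {H = H} free))

  extremal : (H : ThreeGraph n) → (F₃,₂ -Free) H → 2 * δ₂⁺ H ≡ n → (4 ∣ n) × IsCompleteBalanced4Partite H
  extremal H free 2δ≡n with edge-or-δ₂⁺≡0 {H = H}
  ... | inj₁ (x , y , z , xyz) = edge⇒extremal free (trans (sym (2*k≡k+k (δ₂⁺ H))) 2δ≡n) xyz
  -- Positivity of `n` enters here: an edgeless `H` has value 0 and would force `n` to be 0.
  ... | inj₂ δ≡0 = contradiction (trans (sym 2δ≡n) (cong (2 *_) δ≡0)) (≢-nonZero⁻¹ n)
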